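{- Let $k\ge 2$ be an integer and let $\vec c=(c_1,\ldots,c_k)$ be an integer vector with $c_1\ge c_2\ge\cdots\ge c_k$ and $c_k=1$. Let $(\vec X_n)_{n\in\mathbb Z}$ be the $\vec c$-recurrence vector sequence in $\mathbb Z^{k-1}$. Then every $\vec v\in\mathbb Z^{k-1}$ has a unique $\vec c$-satisfying representation; that is, there is exactly one sequence $(a_n)_{n=1}^\infty$ which is a $\vec c$-SR of $\vec v$.
   Context: The $\vec c$-recurrence vector sequence $(\vec X_n)_{n\in\mathbb Z}\subseteq\mathbb Z^{k-1}$ is defined by $\vec X_0=\vec 0$, $\vec X_{ -i}=\vec e_i$ (the $i$-th standard basis vector) for $1\le i\le k-1$, and the recurrence $\vec X_n=c_1\vec X_{n-1}+c_2\vec X_{n-2}+\cdots+c_k\vec X_{n-k}$ for all $n\in\mathbb Z$. Since $c_k=1$, for negative indices this means $\vec X_n=\vec X_{n+k}-\sum_{i=1}^{k-1}c_i\vec X_{n+k-i}$ for all $n\le -k$. Satisfying sequences: let $a=(a_n)_{n=1}^\infty$ be a sequence of nonnegative integers with only finitely many nonzero terms. The property that $a$ is a $\vec c$-SR is defined recursively. The zero sequence is a $\vec c$-SR. If $a$ is nonzero, let $m$ be the largest index with $a_m>0$; then $a$ is a $\vec c$-SR if and only if at least one of the following holds: (i) $m<k$ and $a_n=c_n$ for all $1\le n\le m$; (ii) there exist $s\in\{1,\ldots,k\}$ and $\ell\ge 0$ such that $a_1=c_1,\ldots,a_{s-1}=c_{s-1}$, $a_s<c_s$, $a_{s+1}=\cdots=a_{s+\ell}=0$,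 and the shifted sequence $(a_{s+\ell+n})_{n=1}^\infty$ is a $\vec c$-SR. A $\vec c$-satisfying representation ($\vec c$-SR) of $\vec v\in\mathbb Z^{k-1}$ is a sequence $a$ that is a $\vec c$-SR and satisfies $\vec v=\sum_{n\ge1}a_n\vec X_{ -n}$. -}

module Defs where

import Algebra.Properties.CommutativeMonoid.Sum
open import Data.Bool.Base using (if_then_else_)
open import Data.Fin.Base using (Fin; zero; suc; toℕ; fromℕ; inject₁)
open import Data.Fin.Properties using (toℕ-fromℕ; toℕ-inject₁)
import Data.Fin.Properties as Fin
open import Data.Integer.Base
  using (ℤ; +_; -[1+_]; 0ℤ; 1ℤ; _+_; _*_; _-_)
import Data.Integer.Base as ℤ
import Data.Integer.Properties as ℤ
open import Data.Integer.Tactic.RingSolver using (solve-∀)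
open import Data.Nat.Base as ℕ using (ℕ; zero; suc)
open import Data.Product.Base using (∃; _×_; _,_)
open import Data.Vec.Functional using (Vector)
open import Function.Base using (_∘_)
open import Relation.Binary.PropositionalEquality
  using (_≡_; _≗_; refl; sym; trans; cong; cong₂; module ≡-Reasoning)
open import Relation.Nullary.Decidable using (⌊_⌋)

open Algebra.Properties.CommutativeMonoid.Sum ℤ.+-0-commutativeMonoid
  using (sum; sum-syntax; sum-cong-≗; sum-init-last)

-- A vector (c₁ , … , c_k) is  c : Vector ℤ k,  with  c i  standing for c_{toℕ i + 1}.

NonIncreasing : ∀ {k} → Vector ℤ k → Set
NonIncreasing c = ∀ i j → toℕ i ℕ.≤ toℕ j → c j ℤ.≤ c i

LastIsOne : ∀ {k} → Vector ℤ k → Set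
LastIsOne {k} c = ∀ i → suc (toℕ i) ≡ k → c i ≡ 1ℤ

basis : ∀ {d} → Fin d → Vector ℤ d
basis i j = if ⌊ i Fin.≟ j ⌋ then 1ℤ else 0ℤ

record IsRecurrenceSequence {k} (c : Vector ℤ k) (X : ℤ → Vector ℤ (k ℕ.∸ 1)) : Set where
  field
    at-zero    : ∀ j → X 0ℤ j ≡ 0ℤ
    at-neg     : ∀ i j → X -[1+ toℕ i ] j ≡ basis i j
    recurrence : ∀ n j → X n j ≡ ∑[ i < k ] (c i * X (n - + suc (toℕ i)) j)

-- A sequence (aₙ)ₙ≥₁ is encoded with its index shifted by one:  a n  stands for a_{n+1}.

shift : ℕ → (ℕ → ℕ) → (ℕ → ℕ)
shift p a n = a (p ℕ.+ n)

IsLastNonzero : (ℕ → ℕ) → ℕ → Set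
IsLastNonzero a m = 0 ℕ.< a m × (∀ n → m ℕ.< n → a n ≡ 0)

-- In  prefix  and  block,  m  and  s  are one less than the usual m and s.
-- The inductive reading agrees with recursion on the largest index of a nonzero
-- term: the shift in  block  is by at least one, so that index strictly decreases.
data IsSR {k} (c : Vector ℤ k) : (ℕ → ℕ) → Set where
  null   : ∀ {a} → (∀ n → a n ≡ 0) → IsSR c a
  prefix : ∀ {a} m → IsLastNonzero a m →
           suc m ℕ.< k →
           (∀ i → toℕ i ℕ.≤ m → + a (toℕ i) ≡ c i) →
           IsSR c a
  block  : ∀ {a} m → IsLastNonzero a m →
           (s : Fin k) (ℓ : ℕ) →
           (∀ i → toℕ i ℕ.< toℕ s → + a (toℕ i) ≡ c i) →
           + a (toℕ s) ℤ.< c s →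
           (∀ n → n ℕ.< ℓ → a (suc (toℕ s) ℕ.+ n) ≡ 0) →
           IsSR c (shift (suc (toℕ s) ℕ.+ ℓ) a) →
           IsSR c a

record FiniteSequence : Set where
  field
    term     : ℕ → ℕ
    bound    : ℕ
    vanishes : ∀ n → bound ℕ.≤ n → term n ≡ 0

open FiniteSequence public

-- Sequences are compared by their terms only; the bound is not part of the data.
_≈_ : FiniteSequence → FiniteSequence → Set
a ≈ b = term a ≗ term b

-- Σₙ≥₁ aₙ X₋ₙ; all the terms left out of the finite sum are zero.
value : ∀ {d} → (ℤ → Vector ℤ d) → FiniteSequence → Vector ℤ d
value X a j = ∑[ i < bound a ] (+ term a (toℕ i) * X -[1+ toℕ i ] j)

IsSRof : ∀ {k} → Vector ℤ k → (ℤ → Vector ℤ (k ℕ.∸ 1)) →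
         Vector ℤ (k ℕ.∸ 1) → FiniteSequence → Set
IsSRof c X v a = IsSR c (term a) × v ≗ value X a

-- Recurrence sequences exist whenever the last coefficient is 1. The construction
-- moves a window (Xₙ , Xₙ₋₁ , … , Xₙ₋d), where k = d + 1, one coordinate at a time.
private
  snoc : ∀ {n} → Vector ℤ n → ℤ → Vector ℤ (suc n)
  snoc {zero}  xs x _       = x
  snoc {suc n} xs x zero    = xs zero
  snoc {suc n} xs x (suc i) = snoc (xs ∘ suc) x i

  snoc-inject₁ : ∀ {n} (xs : Vector ℤ n) x i → snoc xs x (inject₁ i) ≡ xs i
  snoc-inject₁ xs x zero    = refl
  snoc-inject₁ xs x (suc i) = snoc-inject₁ (xs ∘ suc) x i

  snoc-fromℕ : ∀ {n} (xs : Vector ℤ n) x → snoc xs x (fromℕ n) ≡ x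
  snoc-fromℕ {zero}  xs x = refl
  snoc-fromℕ {suc n} xs x = snoc-fromℕ (xs ∘ suc) x

  pred-minus : ∀ n t → ℤ.pred n - t ≡ n - (1ℤ + t)
  pred-minus n t = lemma n t
    where
    lemma : ∀ n t → ℤ.-1ℤ + n - t ≡ n - (1ℤ + t)
    lemma = solve-∀

  module Window {d} (c : Vector ℤ (suc d)) (c-last : LastIsOne c) (j : Fin d) where

    start : Vector ℤ (suc d)
    start zero    = 0ℤ
    start (suc i) = basis i j

    forward backward : Vector ℤ (suc d) → Vector ℤ (suc d)
    forward w zero    = ∑[ i < suc d ] (c i * w i)
    forward w (suc i) = w (inject₁ i)
    backward w = snoc (w ∘ suc) (w zero - ∑[ i < d ] (c (inject₁ i) * w (suc i)))

    forward-backward : ∀ w → w ≗ forward (backward w)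
    forward-backward w (suc i) = sym (snoc-inject₁ (w ∘ suc) _ i)
    forward-backward w zero    = sym (begin
      ∑[ i < suc d ] (c i * backward w i)
        ≡⟨ sum-init-last (λ i → c i * backward w i) ⟩
      ∑[ i < d ] (c (inject₁ i) * backward w (inject₁ i))
        + c (fromℕ d) * backward w (fromℕ d)
        ≡⟨ cong₂ _+_
             (sum-cong-≗ λ i → cong (c (inject₁ i) *_) (snoc-inject₁ (w ∘ suc) _ i))
             (cong₂ _*_ (c-last (fromℕ d) (cong suc (toℕ-fromℕ d)))
                        (snoc-fromℕ (w ∘ suc) _)) ⟩
      S + 1ℤ * (w zero - S)
        ≡⟨ rearrange S (w zero) ⟩
      w zero ∎)
      where
      open ≡-Reasoning
      S : ℤ
      S = ∑[ i < d ] (c (inject₁ i) * w (suc i))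
      rearrange : ∀ s x → s + 1ℤ * (x - s) ≡ x
      rearrange = solve-∀

    window : ℤ → Vector ℤ (suc d)
    window (+ zero)     = start
    window (+ suc n)    = forward (window (+ n))
    window -[1+ zero ]  = backward start
    window -[1+ suc n ] = backward (window -[1+ n ])

    window-step : ∀ n → window n ≗ forward (window (ℤ.pred n))
    window-step (+ zero)  = forward-backward start
    window-step (+ suc n) = λ _ → refl
    window-step -[1+ n ]  = forward-backward (window -[1+ n ])

    window-entry : ∀ t n i → toℕ i ≡ t → window n i ≡ window (n - + t) zero
    window-entry zero    n zero    _  = cong (λ m → window m zero) (sym (ℤ.+-identityʳ n))
    window-entry (suc t) n (suc i) eq = begin
      window n (suc i)               ≡⟨ window-step n (suc i) ⟩
      window (ℤ.pred n) (inject₁ i)  ≡⟨ window-entry t (ℤ.pred n) (inject₁ i)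
                                          (trans (toℕ-inject₁ i) (cong ℕ.pred eq)) ⟩
      window (ℤ.pred n - + t) zero   ≡⟨ cong (λ m → window m zero) (pred-minus n (+ t)) ⟩
      window (n - + suc t) zero      ∎
      where
      open ≡-Reasoning

    window-recurrence : ∀ n → window n zero ≡
                        ∑[ i < suc d ] (c i * window (n - + suc (toℕ i)) zero)
    window-recurrence n = trans (window-step n zero)
      (sum-cong-≗ λ i → cong (c i *_)
        (trans (window-entry (toℕ i) (ℤ.pred n) i refl)
               (cong (λ m → window m zero) (pred-minus n (+ toℕ i)))))

recurrenceSequence-exists : ∀ {k} → 1 ℕ.≤ k → (c : Vector ℤ k) → LastIsOne c →
                            ∃ λ X → IsRecurrenceSequence c X
recurrenceSequence-exists {suc d} _ c c-last = (λ n j → window j n zero) , record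
  { at-zero    = λ _ → refl
  ; at-neg     = λ i j → sym (window-entry j (suc (toℕ i)) 0ℤ (suc i) refl)
  ; recurrence = λ n j → window-recurrence j n
  }
  where open Window c c-last

{-# OPTIONS --safe #-}
module Submission where

-- Digits satisfy the recurrence condition exactly when an automaton reading them
-- against c accepts.
--
-- Existence: since c is nonincreasing, an accepted digit string to which one unit is
-- added is either still accepted or admits a carry that trades that unit for one further
-- left, with no larger digit sum elsewhere: where the string first exceeds c, expand one
-- unit X₋ₙ by the recurrence and then subtract c. A unit reaching position 0 disappears,
-- since X₀ = 0, so induction on the digit sum and the position of the unit terminates.
-- Negative entries are first removed by adding multiples of c, again because X₀ = 0.
--
-- Uniqueness: let g be a positive integer sequence with the same recurrence. Modulo
-- g(n+1), the vectors X₋₁ , X₋₂ , … map to g(n) , g(n-1) , … under a linear functional,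
-- because X₀ = 0 does. The weight Σ aᵢ g(n+1-i) of an accepted string is below g(n+1),
-- so equal vectors have equal weights, and the weight determines the string greedily.

open import Defs
open import Data.Empty using (⊥-elim)
open import Data.Fin.Base using (Fin; zero; suc; toℕ; fromℕ; fromℕ<)
import Data.Fin.Properties as Fin
open import Data.Integer.Base as ℤ using (ℤ; +_; -[1+_]; 0ℤ; 1ℤ)
open import Data.Integer.Divisibility.Signed as ℤ using (_∣_; divides)
import Data.Integer.Properties as ℤ
import Data.Integer.Tactic.RingSolver as ℤ-Solver
open import Data.List.Base using (List; []; _∷_; length; map; tabulate; applyUpTo)
open import Data.List.Extrema.Nat using (max; xs≤max)
import Data.List.Properties as List
import Data.List.Relation.Binary.Pointwise as Pointwise
open import Data.List.Relation.Binary.Prefix.Heterogeneous using (Prefix; []; _∷_)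
import Data.List.Relation.Binary.Prefix.Heterogeneous.Properties as Prefix
open import Data.List.Relation.Unary.All as All using (All; []; _∷_)
import Data.List.Relation.Unary.All.Properties as All
import Data.List.Relation.Unary.AllPairs.Properties as AllPairs
open import Data.List.Relation.Unary.Linked as Linked using (Linked; [-]; _∷_)
import Data.List.Relation.Unary.Linked.Properties as Linked
open import Data.Nat.Base
  using (ℕ; zero; suc; pred; _+_; _*_; _∸_; _≤_; _<_; _≥_; z≤n; s≤s; z<s; s<s; s≤s⁻¹; >-nonZero)
import Data.Nat.Divisibility as ℕ
open import Data.Nat.ListAction using (sum)
import Data.Nat.Properties as ℕ
import Data.Nat.Tactic.RingSolver as ℕ-Solver
open import Data.Product using (∃!)
open import Data.Product.Base using (∃; ∃₂; _×_; _,_)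
open import Data.Sum.Base using (_⊎_; inj₁; inj₂)
open import Data.Vec.Functional using (Vector)
open import Function.Base using (_∘_)
open import Relation.Binary.Definitions using (tri<; tri≈; tri>)
open import Relation.Binary.PropositionalEquality
  using (_≡_; _≗_; refl; sym; trans; cong; cong₂; subst; subst₂; module ≡-Reasoning)
open import Relation.Nullary.Decidable using (yes; no)
open import Algebra.Properties.Semiring.Sum ℤ.+-*-semiring
  using (∑-distrib-+; *-distribˡ-sum; sum-cong-≗; sum-replicate-zero)
  renaming (sum to ∑)

-- Arithmetic of digit strings

eval : (ℕ → ℤ) → List ℕ → ℤ
eval Y []       = 0ℤ
eval Y (a ∷ as) = + a ℤ.* Y 0 ℤ.+ eval (Y ∘ suc) as

infixl 6 _⊕_ _⊖_

_⊕_ : List ℕ → List ℕ → List ℕ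
[]       ⊕ bs       = bs
(a ∷ as) ⊕ []       = a ∷ as
(a ∷ as) ⊕ (b ∷ bs) = (a + b) ∷ (as ⊕ bs)

_⊖_ : List ℕ → List ℕ → List ℕ
[]       ⊖ bs       = []
(a ∷ as) ⊖ []       = a ∷ as
(a ∷ as) ⊖ (b ∷ bs) = (a ∸ b) ∷ (as ⊖ bs)

increment : ℕ → List ℕ → List ℕ
increment zero    []       = 1 ∷ []
increment zero    (a ∷ as) = suc a ∷ as
increment (suc q) []       = 0 ∷ increment q []
increment (suc q) (a ∷ as) = a ∷ increment q as

eval-⊕ : ∀ Y as bs → eval Y (as ⊕ bs) ≡ eval Y as ℤ.+ eval Y bs
eval-⊕ Y []       bs       = sym (ℤ.+-identityˡ _)
eval-⊕ Y (a ∷ as) []       = sym (ℤ.+-identityʳ _)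
eval-⊕ Y (a ∷ as) (b ∷ bs) = trans
  (cong (λ e → + (a + b) ℤ.* Y 0 ℤ.+ e) (eval-⊕ (Y ∘ suc) as bs))
  (regroup (+ a) (+ b) (Y 0) _ _)
  where
  regroup : ∀ a b y p q → (a ℤ.+ b) ℤ.* y ℤ.+ (p ℤ.+ q) ≡ (a ℤ.* y ℤ.+ p) ℤ.+ (b ℤ.* y ℤ.+ q)
  regroup = ℤ-Solver.solve-∀

sum-⊕ : ∀ as bs → sum (as ⊕ bs) ≡ sum as + sum bs
sum-⊕ []       bs       = refl
sum-⊕ (a ∷ as) []       = sym (ℕ.+-identityʳ _)
sum-⊕ (a ∷ as) (b ∷ bs) = trans (cong (λ e → a + b + e) (sum-⊕ as bs)) (regroup a b _ _)
  where
  regroup : ∀ a b p q → a + b + (p + q) ≡ a + p + (b + q)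
  regroup = ℕ-Solver.solve-∀

⊖-⊕-cancel : ∀ {as bs} → Prefix _≤_ bs as → (as ⊖ bs) ⊕ bs ≡ as
⊖-⊕-cancel {[]}     []       = refl
⊖-⊕-cancel {a ∷ as} []       = refl
⊖-⊕-cancel          (p ∷ ps) = cong₂ _∷_ (ℕ.m∸n+n≡m p) (⊖-⊕-cancel ps)

eval-⊖ : ∀ Y {as bs} → Prefix _≤_ bs as → eval Y (as ⊖ bs) ℤ.+ eval Y bs ≡ eval Y as
eval-⊖ Y {as} {bs} p =
  trans (sym (eval-⊕ Y (as ⊖ bs) bs)) (cong (eval Y) (⊖-⊕-cancel p))

sum-⊖ : ∀ {as bs} → Prefix _≤_ bs as → sum (as ⊖ bs) + sum bs ≡ sum as
sum-⊖ {as} {bs} p = trans (sym (sum-⊕ (as ⊖ bs) bs)) (cong sum (⊖-⊕-cancel p))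

eval-increment : ∀ Y q as → eval Y (increment q as) ≡ Y q ℤ.+ eval Y as
eval-increment Y zero    []       = cong (ℤ._+ 0ℤ) (ℤ.*-identityˡ (Y 0))
eval-increment Y zero    (a ∷ as) = regroup (+ a) (Y 0) _
  where
  regroup : ∀ a y p → (1ℤ ℤ.+ a) ℤ.* y ℤ.+ p ≡ y ℤ.+ (a ℤ.* y ℤ.+ p)
  regroup = ℤ-Solver.solve-∀
eval-increment Y (suc q) []       =
  trans (ℤ.+-identityˡ _) (eval-increment (Y ∘ suc) q [])
eval-increment Y (suc q) (a ∷ as) = trans
  (cong (λ e → + a ℤ.* Y 0 ℤ.+ e) (eval-increment (Y ∘ suc) q as))
  (regroup (+ a) (Y 0) (Y (suc q)) _)
  where
  regroup : ∀ a y z p → a ℤ.* y ℤ.+ (z ℤ.+ p) ≡ z ℤ.+ (a ℤ.* y ℤ.+ p)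
  regroup = ℤ-Solver.solve-∀

sum-increment : ∀ q as → sum (increment q as) ≡ suc (sum as)
sum-increment zero    []       = refl
sum-increment zero    (a ∷ as) = refl
sum-increment (suc q) []       = sum-increment q []
sum-increment (suc q) (a ∷ as) =
  trans (cong (_+_ a) (sum-increment q as)) (ℕ.+-suc a (sum as))

-- Drives the induction on the digit sum: either there is a unit to take out, or the string has
-- value zero whatever `Y` is.
extract : ∀ as → (∀ Y → eval Y as ≡ 0ℤ) ⊎ ∃₂ λ q bs → as ≡ increment q bs
extract []           = inj₁ λ _ → refl
extract (suc a ∷ as) = inj₂ (0 , a ∷ as , refl)
extract (zero  ∷ as) with extract as
... | inj₁ zeros           = inj₁ λ Y → trans (ℤ.+-identityˡ _) (zeros (Y ∘ suc))
... | inj₂ (q , bs , eq) = inj₂ (suc q , 0 ∷ bs , cong (0 ∷_) eq)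

-- Carrying

-- An automaton for digit strings: the first list is what remains of the
-- coefficient string after the part the digits have matched since the last reset.
data Admissible (cs : List ℕ) : List ℕ → List ℕ → Set where
  []    : ∀ {t} → Admissible cs t []
  below : ∀ {x t a as} → a < x → Admissible cs cs as → Admissible cs (x ∷ t) (a ∷ as)
  match : ∀ {x y t as} → Admissible cs (y ∷ t) as → Admissible cs (x ∷ y ∷ t) (x ∷ as)

-- Y j stands for a coordinate of X₋ⱼ.
Recurrent : List ℕ → (ℕ → ℤ) → Set
Recurrent cs Y = ∀ j → Y j ≡ eval (λ i → Y (suc j + i)) cs

-- The digits `bs` are traded for `t`, the coefficients still to be matched, and a remainder.
-- `shrinks` allows for expanding one unit into `cs`; for `t = cs` it says that the remainder has a
-- smaller digit sum than `bs`.
record Carry (cs t bs : List ℕ) : Set where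
  constructor carry
  field
    remainder : List ℕ
    preserves : ∀ Y → Recurrent cs Y → eval Y remainder ℤ.+ eval Y t ≡ eval Y bs
    shrinks   : suc (sum remainder + sum t) ≤ sum bs + sum cs

-- Z 0 stands for X₀ = 0, so a unit that slides to position 0 vanishes.
record Slide (cs : List ℕ) (q : ℕ) (bs : List ℕ) : Set where
  constructor slid
  field
    position  : ℕ
    remainder : List ℕ
    closer    : position ≤ q
    shrinks   : sum remainder ≤ sum bs
    preserves : ∀ Z → Recurrent cs Z →
      Z (suc q) ℤ.+ eval (Z ∘ suc) bs ≡ Z position ℤ.+ eval (Z ∘ suc) remainder

module _ {c cs′} (positive : All (0 <_) (c ∷ cs′)) (decreasing : Linked _≥_ (c ∷ cs′)) where

  private
    cs : List ℕ
    cs = c ∷ cs′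

    0<c : 0 < c
    0<c = All.head positive

    0<sum : 0 < sum cs
    0<sum = ℕ.<-≤-trans 0<c (ℕ.m≤m+n c _)

  -- Of the `b - x` surplus units one is expanded by the recurrence into `cs` on the following
  -- places, where it covers `t`; the other `y` stay.
  carry-exceed : ∀ {x t b bs} → Prefix _≤_ t cs → x < b → Carry cs (x ∷ t) (b ∷ bs)
  carry-exceed {x} {t} {b} {bs} t≤cs x<b with y , refl ← ℕ.m≤n⇒∃[o]m+o≡n x<b =
    carry (y ∷ (bs ⊕ (cs ⊖ t))) same (ℕ.≤-reflexive size)
    where
    same : ∀ Y → Recurrent cs Y →
           eval Y (y ∷ (bs ⊕ (cs ⊖ t))) ℤ.+ eval Y (x ∷ t) ≡ eval Y (suc x + y ∷ bs)
    same Y rec = begin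
      + y ℤ.* Y 0 ℤ.+ eval Y′ (bs ⊕ (cs ⊖ t)) ℤ.+ (+ x ℤ.* Y 0 ℤ.+ eval Y′ t)
        ≡⟨ cong (λ e → + y ℤ.* Y 0 ℤ.+ e ℤ.+ (+ x ℤ.* Y 0 ℤ.+ eval Y′ t)) (eval-⊕ Y′ bs _) ⟩
      + y ℤ.* Y 0 ℤ.+ (eval Y′ bs ℤ.+ eval Y′ (cs ⊖ t)) ℤ.+ (+ x ℤ.* Y 0 ℤ.+ eval Y′ t)
        ≡⟨ regroup (+ y) (+ x) (Y 0) (eval Y′ bs) _ _ ⟩
      (+ y ℤ.+ + x) ℤ.* Y 0 ℤ.+ eval Y′ bs ℤ.+ (eval Y′ (cs ⊖ t) ℤ.+ eval Y′ t)
        ≡⟨ cong (λ e → (+ y ℤ.+ + x) ℤ.* Y 0 ℤ.+ eval Y′ bs ℤ.+ e)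
             (trans (eval-⊖ Y′ t≤cs) (sym (rec 0))) ⟩
      (+ y ℤ.+ + x) ℤ.* Y 0 ℤ.+ eval Y′ bs ℤ.+ Y 0
        ≡⟨ absorb (+ y) (+ x) (Y 0) _ ⟩
      + (suc x + y) ℤ.* Y 0 ℤ.+ eval Y′ bs ∎
      where
      open ≡-Reasoning
      Y′ : ℕ → ℤ
      Y′ = Y ∘ suc
      regroup : ∀ y x w b d t → y ℤ.* w ℤ.+ (b ℤ.+ d) ℤ.+ (x ℤ.* w ℤ.+ t) ≡
                (y ℤ.+ x) ℤ.* w ℤ.+ b ℤ.+ (d ℤ.+ t)
      regroup = ℤ-Solver.solve-∀
      absorb : ∀ y x w b → (y ℤ.+ x) ℤ.* w ℤ.+ b ℤ.+ w ≡ (1ℤ ℤ.+ x ℤ.+ y) ℤ.* w ℤ.+ b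
      absorb = ℤ-Solver.solve-∀
    size : suc (y + sum (bs ⊕ (cs ⊖ t)) + (x + sum t)) ≡ suc x + y + sum bs + sum cs
    size = begin
      suc (y + sum (bs ⊕ (cs ⊖ t)) + (x + sum t))
        ≡⟨ cong (λ e → suc (y + e + (x + sum t))) (sum-⊕ bs _) ⟩
      suc (y + (sum bs + sum (cs ⊖ t)) + (x + sum t))
        ≡⟨ regroup y x (sum bs) _ _ ⟩
      suc x + y + sum bs + (sum (cs ⊖ t) + sum t)
        ≡⟨ cong (λ e → suc x + y + sum bs + e) (sum-⊖ t≤cs) ⟩
      suc x + y + sum bs + sum cs ∎
      where
      open ≡-Reasoning
      regroup : ∀ y x b d t → suc (y + (b + d) + (x + t)) ≡ suc x + y + b + (d + t)
      regroup = ℕ-Solver.solve-∀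

  carry-match : ∀ {x t bs} → Carry cs t bs → Carry cs (x ∷ t) (x ∷ bs)
  carry-match {x} {t} {bs} (carry as same size) = carry (0 ∷ as) same′ size′
    where
    same′ : ∀ Y → Recurrent cs Y → eval Y (0 ∷ as) ℤ.+ eval Y (x ∷ t) ≡ eval Y (x ∷ bs)
    same′ Y rec = trans (regroup (+ x ℤ.* Y 0) (eval (Y ∘ suc) as) _)
      (cong (λ e → + x ℤ.* Y 0 ℤ.+ e) (same (Y ∘ suc) (rec ∘ suc)))
      where
      regroup : ∀ w a t → 0ℤ ℤ.+ a ℤ.+ (w ℤ.+ t) ≡ w ℤ.+ (a ℤ.+ t)
      regroup = ℤ-Solver.solve-∀
    size′ : suc (sum as + (x + sum t)) ≤ x + sum bs + sum cs
    size′ = begin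
      suc (sum as + (x + sum t))  ≡⟨ regroup (sum as) x (sum t) ⟩
      x + suc (sum as + sum t)    ≤⟨ ℕ.+-monoʳ-≤ x size ⟩
      x + (sum bs + sum cs)       ≡⟨ ℕ.+-assoc x _ _ ⟨
      x + sum bs + sum cs         ∎
      where
      open ℕ.≤-Reasoning
      regroup : ∀ a x t → suc (a + (x + t)) ≡ x + suc (a + t)
      regroup = ℕ-Solver.solve-∀

  -- Here the digits have spelled out all the coefficients, so no unit has to be expanded, and the
  -- strict decrease comes from `0<sum`.
  carry-[] : ∀ {bs} → Carry cs [] bs
  carry-[] {bs} = carry bs (λ Y _ → ℤ.+-identityʳ _) (begin
    suc (sum bs + 0)  ≡⟨ ℕ.+-suc (sum bs) 0 ⟨
    sum bs + 1        ≤⟨ ℕ.+-monoʳ-≤ (sum bs) 0<sum ⟩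
    sum bs + sum cs   ∎)
    where open ℕ.≤-Reasoning

  -- A nonincreasing list dominates its own tail entry by entry.
  tail≤cs : ∀ {x t} → Linked _≥_ (x ∷ t) → Prefix _≤_ (x ∷ t) cs → Prefix _≤_ t cs
  tail≤cs dec p = Prefix.trans ℕ.≤-trans (tail≤ dec) p
    where
    tail≤ : ∀ {x t} → Linked _≥_ (x ∷ t) → Prefix _≤_ t (x ∷ t)
    tail≤ [-]       = []
    tail≤ (p ∷ dec) = p ∷ tail≤ dec

  mutual

    -- The string is read against `x ∷ t` alongside its accepting run against the larger `u`. While
    -- digits match the smaller coefficients, what remains of them stays dominated: by the tail of
    -- `u`, or by `tail≤cs` if the other run resets to `cs`. The first digit that differs either
    -- drops below, which resets both runs, or exceeds and gives a carry.
    weaken : ∀ {x t u bs} → Linked _≥_ (x ∷ t) → Prefix _≤_ (x ∷ t) cs → Prefix _≤_ (x ∷ t) u →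
             Admissible cs u bs → Admissible cs (x ∷ t) bs ⊎ Carry cs (x ∷ t) bs
    weaken _ _ _ [] = inj₁ []
    weaken {x} {bs = b ∷ _} dec t≤cs (x≤x′ ∷ t≤u) adm with ℕ.<-cmp b x | adm
    ... | tri> _ _ x<b  | _            = inj₂ (carry-exceed (tail≤cs dec t≤cs) x<b)
    ... | tri≈ _ refl _ | below _ adm′ = weaken-match dec t≤cs (tail≤cs dec t≤cs) adm′
    ... | tri≈ _ refl _ | match adm′   = weaken-match dec t≤cs t≤u adm′
    ... | tri< b<x _ _  | below _ adm′ = inj₁ (below b<x adm′)
    ... | tri< b<x _ _  | match _      = ⊥-elim (ℕ.<⇒≱ b<x x≤x′)

    weaken-match : ∀ {x t u bs} → Linked _≥_ (x ∷ t) → Prefix _≤_ (x ∷ t) cs → Prefix _≤_ t u →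
                   Admissible cs u bs →
                   Admissible cs (x ∷ t) (x ∷ bs) ⊎ Carry cs (x ∷ t) (x ∷ bs)
    -- The automaton has no `match` for the last coefficient: reaching it already completes a carry.
    weaken-match {t = []}    _   _    _   _   = inj₂ (carry-match carry-[])
    weaken-match {t = y ∷ t} dec t≤cs t≤u adm
      with weaken (Linked.tail dec) (tail≤cs dec t≤cs) t≤u adm
    ... | inj₁ adm′  = inj₁ (match adm′)
    ... | inj₂ over = inj₂ (carry-match over)

  cs≤cs : Prefix _≤_ cs cs
  cs≤cs = Prefix.fromPointwise (Pointwise.refl ℕ.≤-refl)

  increment-head : ∀ {bs} → Admissible cs cs bs →
                   Admissible cs cs (increment 0 bs) ⊎ Carry cs cs (increment 0 bs)
  -- The empty string is read as a single zero; both increments are `1 ∷ []`.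
  increment-head {[]}     _   = increment-head {0 ∷ []} (below 0<c [])
  increment-head {b ∷ bs} adm with ℕ.<-cmp (suc b) c | adm
  ... | tri> _ _ c<1+b | _            = inj₂ (carry-exceed (tail≤cs decreasing cs≤cs) c<1+b)
  ... | tri≈ _ refl _  | below _ adm′ =
    weaken-match decreasing cs≤cs (tail≤cs decreasing cs≤cs) adm′
  ... | tri< 1+b<c _ _ | below _ adm′ = inj₁ (below 1+b<c adm′)
  ... | tri< 1+b<c _ _ | match _      = ⊥-elim (ℕ.<⇒≱ 1+b<c (ℕ.n≤1+n b))

  cons-slide : ∀ {q bs} → Slide cs q bs → Slide cs (suc q) (0 ∷ bs)
  cons-slide {q} {bs} (slid p as p≤q size same) =
    slid (suc p) (0 ∷ as) (s≤s p≤q) size λ Z rec → trans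
      (cong (λ e → Z (suc (suc q)) ℤ.+ e) (ℤ.+-identityˡ _))
      (trans (same (Z ∘ suc) (rec ∘ suc)) (cong (λ e → Z (suc p) ℤ.+ e) (sym (ℤ.+-identityˡ _))))

  -- A carry out of the first place leaves `cs`, which the recurrence contracts to a unit at
  -- position 0. The remainder of a slide need not be accepted; `place` normalizes it again.
  slide : ∀ q bs → Admissible cs cs bs → Admissible cs cs (increment q bs) ⊎ Slide cs q bs
  slide zero bs adm with increment-head adm
  ... | inj₁ adm′             = inj₁ adm′
  ... | inj₂ (carry as same size) = inj₂ (slid 0 as z≤n size′ λ Z rec → begin
    Z 1 ℤ.+ eval (Z ∘ suc) bs                     ≡⟨ eval-increment (Z ∘ suc) 0 bs ⟨
    eval (Z ∘ suc) (increment 0 bs)               ≡⟨ same (Z ∘ suc) (rec ∘ suc) ⟨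
    eval (Z ∘ suc) as ℤ.+ eval (Z ∘ suc) cs       ≡⟨ ℤ.+-comm (eval (Z ∘ suc) as) _ ⟩
    eval (Z ∘ suc) cs ℤ.+ eval (Z ∘ suc) as       ≡⟨ cong (ℤ._+ eval (Z ∘ suc) as) (rec 0) ⟨
    Z 0 ℤ.+ eval (Z ∘ suc) as                     ∎)
    where
    open ≡-Reasoning
    size′ : sum as ≤ sum bs
    size′ = ℕ.+-cancelʳ-≤ (sum cs) _ _ (s≤s⁻¹
      (ℕ.≤-trans size (ℕ.≤-reflexive (cong (_+ sum cs) (sum-increment 0 bs)))))
  slide (suc q) []           adm with slide q [] adm
  ... | inj₁ adm′             = inj₁ (below 0<c adm′)
  ... | inj₂ (slid p as p≤q size same) = inj₂ (slid (suc p) (0 ∷ as) (s≤s p≤q) size λ Z rec →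
    trans (same (Z ∘ suc) (rec ∘ suc)) (cong (λ e → Z (suc p) ℤ.+ e) (sym (ℤ.+-identityˡ _))))
  slide (suc q) (zero ∷ bs)  (match _) = ⊥-elim (ℕ.n≮n 0 0<c)
  slide (suc q) (zero ∷ bs)  (below _ adm) with slide q bs adm
  ... | inj₁ adm′ = inj₁ (below 0<c adm′)
  ... | inj₂ s    = inj₂ (cons-slide s)
  -- Units trade roles: the pending one is deposited in the tail, and one from the first digit
  -- becomes pending at position 1.
  slide (suc q) (suc b ∷ bs) _ =
    inj₂ (slid 1 (b ∷ increment q bs) (s≤s z≤n) (ℕ.≤-reflexive size) λ Z _ → begin
      Z (2 + q) ℤ.+ (+ suc b ℤ.* Z 1 ℤ.+ eval (λ i → Z (2 + i)) bs)
        ≡⟨ regroup (Z (2 + q)) (+ b) (Z 1) _ ⟩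
      Z 1 ℤ.+ (+ b ℤ.* Z 1 ℤ.+ (Z (2 + q) ℤ.+ eval (λ i → Z (2 + i)) bs))
        ≡⟨ cong (λ e → Z 1 ℤ.+ (+ b ℤ.* Z 1 ℤ.+ e)) (eval-increment (λ i → Z (2 + i)) q bs) ⟨
      Z 1 ℤ.+ (+ b ℤ.* Z 1 ℤ.+ eval (λ i → Z (2 + i)) (increment q bs)) ∎)
    where
    open ≡-Reasoning
    regroup : ∀ z b y e → z ℤ.+ ((1ℤ ℤ.+ b) ℤ.* y ℤ.+ e) ≡ y ℤ.+ (b ℤ.* y ℤ.+ (z ℤ.+ e))
    regroup = ℤ-Solver.solve-∀
    size : b + sum (increment q bs) ≡ suc b + sum bs
    size = trans (cong (_+_ b) (sum-increment q bs)) (ℕ.+-suc b _)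

  -- `val` depends on `Z`, so that a single string serves all coordinates of a vector at once.
  Normal : ℕ → ((ℕ → ℤ) → ℤ) → Set
  Normal D val = ∃ λ bs → Admissible cs cs bs × sum bs ≤ D ×
    (∀ Z → Recurrent cs Z → Z 0 ≡ 0ℤ → eval (Z ∘ suc) bs ≡ val Z)

  -- Inner induction, on a bound `n` for the position of the pending unit. Each slide moves the unit
  -- strictly left without raising the digit sum of the rest, so `norm`, the hypothesis of the outer
  -- induction on `D`, applies to the remainder.
  place : ∀ {D} → (∀ as → sum as ≤ D → Normal D (λ Z → eval (Z ∘ suc) as)) →
          ∀ n p → p ≤ n → ∀ bs → Admissible cs cs bs → sum bs ≤ D →
          Normal (suc D) (λ Z → Z p ℤ.+ eval (Z ∘ suc) bs)
  place norm n zero _ bs adm size = bs , adm , ℕ.m≤n⇒m≤1+n size , λ Z _ Z₀ →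
    sym (trans (cong (ℤ._+ eval (Z ∘ suc) bs) Z₀) (ℤ.+-identityˡ _))
  place norm (suc n) (suc q) (s≤s q≤n) bs adm size with slide q bs adm
  ... | inj₁ adm′ = increment q bs , adm′ ,
    ℕ.≤-trans (ℕ.≤-reflexive (sum-increment q bs)) (s≤s size) ,
    λ Z _ _ → eval-increment (Z ∘ suc) q bs
  ... | inj₂ (slid p as p≤q size′ same)
    with bs₁ , adm₁ , size₁ , same₁ ← norm as (ℕ.≤-trans size′ size)
    with bs₂ , adm₂ , size₂ , same₂ ← place norm n p (ℕ.≤-trans p≤q q≤n) bs₁ adm₁ size₁
    = bs₂ , adm₂ , size₂ , λ Z rec Z₀ → trans (same₂ Z rec Z₀)
        (trans (cong (λ e → Z p ℤ.+ e) (same₁ Z rec Z₀)) (sym (same Z rec)))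

  normalize : ∀ D as → sum as ≤ D → Normal D (λ Z → eval (Z ∘ suc) as)
  normalize D as size with extract as
  ... | inj₁ zeros = [] , [] , z≤n , λ Z _ _ → sym (zeros (Z ∘ suc))
  normalize zero    as size | inj₂ (q , bs , refl) =
    ⊥-elim (ℕ.n≮0 (subst (_≤ 0) (sum-increment q bs) size))
  normalize (suc D) as size | inj₂ (q , bs , refl)
    with bs₁ , adm₁ , size₁ , same₁ ←
           normalize D bs (s≤s⁻¹ (subst (_≤ suc D) (sum-increment q bs) size))
    with bs₂ , adm₂ , size₂ , same₂ ← place (normalize D) (suc q) (suc q) ℕ.≤-refl bs₁ adm₁ size₁
    = bs₂ , adm₂ , size₂ , λ Z rec Z₀ → trans (same₂ Z rec Z₀)
        (trans (cong (λ e → Z (suc q) ℤ.+ e) (same₁ Z rec Z₀))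
          (sym (eval-increment (Z ∘ suc) q bs)))

-- Weights

weigh : (ℕ → ℕ) → List ℕ → ℕ
weigh w []       = 0
weigh w (a ∷ as) = a * w 0 + weigh (w ∘ suc) as

eval-weigh : ∀ w as → eval (+_ ∘ w) as ≡ + weigh w as
eval-weigh w []       = refl
eval-weigh w (a ∷ as) = cong₂ ℤ._+_ (sym (ℤ.pos-* a (w 0))) (eval-weigh (w ∘ suc) as)

eval-minus : ∀ Y Z as → eval (λ i → Y i ℤ.- Z i) as ≡ eval Y as ℤ.- eval Z as
eval-minus Y Z []       = refl
eval-minus Y Z (a ∷ as) = trans
  (cong (λ e → + a ℤ.* (Y 0 ℤ.- Z 0) ℤ.+ e) (eval-minus (Y ∘ suc) (Z ∘ suc) as))
  (regroup (+ a) (Y 0) (Z 0) _ _)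
  where
  regroup : ∀ a y z p q →
    a ℤ.* (y ℤ.- z) ℤ.+ (p ℤ.- q) ≡ a ℤ.* y ℤ.+ p ℤ.- (a ℤ.* z ℤ.+ q)
  regroup = ℤ-Solver.solve-∀

eval-∑ : ∀ {d} (Y : Fin d → ℕ → ℤ) (w : Vector ℤ d) as →
  eval (λ i → ∑ (λ j → Y j i ℤ.* w j)) as ≡ ∑ (λ j → eval (Y j) as ℤ.* w j)
eval-∑ {d} Y w [] = sym (trans (sum-cong-≗ (λ j → ℤ.*-zeroˡ (w j))) (sum-replicate-zero d))
eval-∑ Y w (a ∷ as) = begin
  + a ℤ.* ∑ (λ j → Y j 0 ℤ.* w j) ℤ.+ eval (λ i → ∑ (λ j → Y j (suc i) ℤ.* w j)) as
    ≡⟨ cong₂ ℤ._+_ (*-distribˡ-sum (+ a) (λ j → Y j 0 ℤ.* w j)) (eval-∑ (λ j → Y j ∘ suc) w as) ⟩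
  ∑ (λ j → + a ℤ.* (Y j 0 ℤ.* w j)) ℤ.+ ∑ (λ j → eval (Y j ∘ suc) as ℤ.* w j)
    ≡⟨ ∑-distrib-+ (λ j → + a ℤ.* (Y j 0 ℤ.* w j)) _ ⟨
  ∑ (λ j → + a ℤ.* (Y j 0 ℤ.* w j) ℤ.+ eval (Y j ∘ suc) as ℤ.* w j)
    ≡⟨ sum-cong-≗ (λ j → factor (+ a) (Y j 0) (w j) _) ⟩
  ∑ (λ j → eval (Y j) (a ∷ as) ℤ.* w j) ∎
  where
  open ≡-Reasoning
  factor : ∀ a y w e → a ℤ.* (y ℤ.* w) ℤ.+ e ℤ.* w ≡ (a ℤ.* y ℤ.+ e) ℤ.* w
  factor = ℤ-Solver.solve-∀

∣-eval : ∀ {g} Y as → (∀ i → i < length as → g ∣ Y i) → g ∣ eval Y as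
∣-eval Y []       _ = divides 0ℤ refl
∣-eval Y (a ∷ as) p = ℤ.∣m∣n⇒∣m+n (ℤ.∣n⇒∣m*n (+ a) (p 0 z<s))
  (∣-eval (Y ∘ suc) as (λ i → p (suc i) ∘ s<s))

-- As the last coefficient is 1, the sum is `Y d` plus multiples of `g`: modulo `g` the recurrence
-- is solved for its farthest term.
∣-last : ∀ {g} d (f : Fin (suc d) → ℕ) → f (fromℕ d) ≡ 1 → ∀ Y →
         (∀ i → i < d → g ∣ Y i) → g ∣ eval Y (tabulate f) → g ∣ Y d
∣-last {g} zero    f f≡1 Y _ g∣e = subst (g ∣_)
  (trans (ℤ.+-identityʳ _) (trans (cong (λ a → + a ℤ.* Y 0) f≡1) (ℤ.*-identityˡ (Y 0)))) g∣e
∣-last     (suc d) f f≡1 Y p g∣e = ∣-last d (f ∘ suc) f≡1 (Y ∘ suc) (λ i → p (suc i) ∘ s<s)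
  (ℤ.∣m+n∣m⇒∣n g∣e (ℤ.∣n⇒∣m*n (+ f zero) (p 0 z<s)))

-- The distance of `m` and `n` is at most their maximum, hence less than `g`.
∣-difference⇒≡ : ∀ {m n g} → m < g → n < g → + g ∣ + m ℤ.- + n → m ≡ n
∣-difference⇒≡ {m} {n} {g} m<g n<g g∣m-n with ℤ.∣ + m ℤ.- + n ∣ in eq
... | zero = ℤ.+-injective (ℤ.i-j≡0⇒i≡j (+ m) (+ n) (ℤ.∣i∣≡0⇒i≡0 eq))
... | suc e = ⊥-elim (ℕ.<⇒≱ small (ℕ.∣⇒≤ (subst (g ℕ.∣_) eq (ℤ.∣⇒∣ᵤ g∣m-n))))
  where
  small : suc e < g
  small = ℕ.≤-<-trans
    (ℕ.≤-trans (ℕ.≤-reflexive (trans (sym eq) (cong ℤ.∣_∣ (ℤ.[+m]-[+n]≡m⊖n m n))))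
               (ℤ.∣m⊝n∣≤m⊔n m n))
    (ℕ.⊔-lub m<g n<g)

-- window cs n i is g (n - i) for the sequence g with g m = 1 for m ≤ 0 that obeys
-- the recurrence with coefficients cs from g 1 on.
window : List ℕ → ℕ → ℕ → ℕ
window cs zero    i       = 1
window cs (suc n) zero    = weigh (window cs n) cs
window cs (suc n) (suc i) = window cs n i

-- Entry `j` is g (n - j), and `j < n` keeps this index positive.
window-recurrence : ∀ cs n j → j < n →
  window cs n j ≡ weigh (λ i → window cs n (suc j + i)) cs
window-recurrence cs (suc n) zero    _         = refl
window-recurrence cs (suc n) (suc j) (s<s j<n) = window-recurrence cs n j j<n

module _ {c cs′} (positive : All (0 <_) (c ∷ cs′)) where

  private
    cs : List ℕ
    cs = c ∷ cs′

    0<c : 0 < c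
    0<c = All.head positive

    W : ℕ → ℕ → ℕ
    W = window cs

  window>0 : ∀ n i → 0 < W n i
  window>0 zero    i       = z<s
  window>0 (suc n) zero    =
    ℕ.<-≤-trans (ℕ.*-mono-< 0<c (window>0 n 0)) (ℕ.m≤m+n _ _)
  window>0 (suc n) (suc i) = window>0 n i

  -- A digit below its coefficient saves at least one unit of its place, whose weight is that of
  -- `cs` on the places after it; by induction the rest, accepted against `cs`, weighs less than
  -- that. The bound on the length keeps all places where the recurrence holds.
  weigh< : ∀ {x t as} n → All (0 <_) (x ∷ t) → Admissible cs (x ∷ t) as → length as ≤ n →
           weigh (W n) as < weigh (W n) (x ∷ t)
  weigh< n (0<x ∷ _) [] _ =
    ℕ.<-≤-trans (ℕ.*-mono-< 0<x (window>0 n 0)) (ℕ.m≤m+n _ _)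
  weigh< {x} {t} {a ∷ as} (suc n) _ (below a<x adm) (s≤s len) = begin-strict
    a * W (suc n) 0 + weigh (W n) as  <⟨ ℕ.+-monoʳ-< (a * W (suc n) 0) (weigh< n positive adm len) ⟩
    a * W (suc n) 0 + W (suc n) 0     ≡⟨ ℕ.+-comm (a * W (suc n) 0) _ ⟩
    suc a * W (suc n) 0               ≤⟨ ℕ.*-monoˡ-≤ (W (suc n) 0) a<x ⟩
    x * W (suc n) 0                   ≤⟨ ℕ.m≤m+n _ _ ⟩
    x * W (suc n) 0 + weigh (W n) t   ∎
    where open ℕ.≤-Reasoning
  weigh< {x} (suc n) (_ ∷ pos) (match adm) (s≤s len) =
    ℕ.+-monoʳ-< (x * W (suc n) 0) (weigh< n pos adm len)

  -- The smaller string is accepted against the one-letter coefficient string `b ∷ []`, so `weigh<`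
  -- already bounds it by the leading digit of the other.
  weigh-head< : ∀ {a b as n} bs → a < b → Admissible cs cs as → length as ≤ n →
                weigh (W (suc n)) (a ∷ as) < weigh (W (suc n)) (b ∷ bs)
  weigh-head< {n = n} bs a<b adm len =
    ℕ.<-≤-trans (weigh< {t = []} (suc n) (ℕ.≤-<-trans z≤n a<b ∷ []) (below a<b adm) (s≤s len))
      (ℕ.+-monoʳ-≤ _ z≤n)

  -- Distinct first digits would give distinct weights by `weigh-head<`. Equal ones lead the
  -- automaton to the same state on both sides and cancel.
  weigh-injective : ∀ {t as bs} n → Admissible cs t as → Admissible cs t bs →
                    length as ≡ length bs → length as ≤ n →
                    weigh (W n) as ≡ weigh (W n) bs → as ≡ bs
  weigh-injective {as = []} {[]} _ _ _ _ _ _ = refl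
  weigh-injective {as = a ∷ as} {b ∷ bs} (suc n) (below a<x adm) (below b<x adm′)
                  len (s≤s as≤n) eq with ℕ.<-cmp a b
  ... | tri< a<b _ _  = ⊥-elim (ℕ.<⇒≢ (weigh-head< bs a<b adm as≤n) eq)
  ... | tri> _ _ b<a  = ⊥-elim (ℕ.<⇒≢ (weigh-head< as b<a adm′
                          (subst (_≤ n) (ℕ.suc-injective len) as≤n)) (sym eq))
  ... | tri≈ _ refl _ = cong (a ∷_) (weigh-injective n adm adm′ (ℕ.suc-injective len) as≤n
                          (ℕ.+-cancelˡ-≡ (a * W (suc n) 0) _ _ eq))
  weigh-injective {bs = b ∷ bs} (suc n) (below a<x adm) (match _) _ (s≤s as≤n) eq =
    ⊥-elim (ℕ.<⇒≢ (weigh-head< bs a<x adm as≤n) eq)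
  weigh-injective {as = a ∷ as} (suc n) (match _) (below b<x adm) len (s≤s as≤n) eq =
    ⊥-elim (ℕ.<⇒≢ (weigh-head< as b<x adm (subst (_≤ n) (ℕ.suc-injective len) as≤n)) (sym eq))
  weigh-injective {as = a ∷ as} (suc n) (match adm) (match adm′) len (s≤s as≤n) eq =
    cong (a ∷_) (weigh-injective n adm adm′ (ℕ.suc-injective len) as≤n
      (ℕ.+-cancelˡ-≡ (a * W (suc n) 0) _ _ eq))

-- Weights and linear functionals modulo g (n + 1)

module _ {d} (f : Fin (suc d) → ℕ) (f-last : f (fromℕ d) ≡ 1) where

  private
    cs : List ℕ
    cs = tabulate f

  -- The difference `e` of the two sequences obeys the recurrence and starts with g (n + 1) followed
  -- by `d` zeros, all divisible by g (n + 1); divisibility then spreads to the later places.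
  window-congruent : ∀ n {P} → Recurrent cs P → P 0 ≡ 0ℤ →
    (∀ i → i < d → P (suc i) ≡ + window cs n i) →
    ∀ i → i < n → + window cs (suc n) 0 ∣ + window cs n i ℤ.- P (suc i)
  window-congruent n {P} rec P₀ P-neg i i<n =
    subst (λ m → g ∣ e m) (ℕ.+-identityʳ (suc i)) (divisible (suc i) (s≤s (ℕ.<⇒≤ i<n)) 0 z≤n)
    where
    g : ℤ
    g = + window cs (suc n) 0
    e : ℕ → ℤ
    e j = + window cs (suc n) j ℤ.- P j
    e-recurrence : ∀ j → j ≤ n → e j ≡ eval (λ i → e (suc j + i)) cs
    e-recurrence j j≤n = begin
      + window cs (suc n) j ℤ.- P j
        ≡⟨ cong₂ ℤ._-_ (cong +_ (window-recurrence cs (suc n) j (s≤s j≤n))) (rec j) ⟩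
      + weigh W cs ℤ.- eval P′ cs          ≡⟨ cong (ℤ._- eval P′ cs) (eval-weigh W cs) ⟨
      eval (+_ ∘ W) cs ℤ.- eval P′ cs      ≡⟨ eval-minus (+_ ∘ W) P′ cs ⟨
      eval (λ i → e (suc j + i)) cs        ∎
      where
      open ≡-Reasoning
      W : ℕ → ℕ
      W i = window cs (suc n) (suc j + i)
      P′ : ℕ → ℤ
      P′ i = P (suc j + i)
    -- The invariant is divisibility at the `d + 1` places from `j` on; only the last place of the
    -- next stretch is new.
    divisible : ∀ j → j ≤ suc n → ∀ i → i ≤ d → g ∣ e (j + i)
    divisible zero _ zero _ = divides 1ℤ
      (trans (cong (λ p → g ℤ.- p) P₀) (trans (ℤ.+-identityʳ g) (sym (ℤ.*-identityˡ g))))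
    divisible zero _ (suc i) i<d = divides 0ℤ (ℤ.i≡j⇒i-j≡0 (sym (P-neg i i<d)))
    divisible (suc j) (s≤s j≤n) i i≤d with ℕ.m≤n⇒m<n∨m≡n i≤d
    ... | inj₁ i<d  = subst (λ m → g ∣ e m) (ℕ.+-suc j i)
      (divisible j (ℕ.m≤n⇒m≤1+n j≤n) (suc i) i<d)
    ... | inj₂ refl = ∣-last d f f-last (λ i → e (suc j + i))
      (λ i i<d → subst (λ m → g ∣ e m) (ℕ.+-suc j i)
        (divisible j (ℕ.m≤n⇒m≤1+n j≤n) (suc i) i<d))
      (subst (g ∣_) (e-recurrence j j≤n)
        (subst (λ m → g ∣ e m) (ℕ.+-identityʳ j) (divisible j (ℕ.m≤n⇒m≤1+n j≤n) 0 z≤n)))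

-- Sequences and digit strings

digit : List ℕ → ℕ → ℕ
digit []       n       = 0
digit (a ∷ as) zero    = a
digit (a ∷ as) (suc n) = digit as n

digit-vanishes : ∀ as n → length as ≤ n → digit as n ≡ 0
digit-vanishes []       n       _       = refl
digit-vanishes (a ∷ as) (suc n) (s≤s p) = digit-vanishes as n p

applyUpTo-digit : ∀ as → applyUpTo (digit as) (length as) ≡ as
applyUpTo-digit []       = refl
applyUpTo-digit (a ∷ as) = cong (a ∷_) (applyUpTo-digit as)

applyUpTo-cong : ∀ {a b : ℕ → ℕ} → a ≗ b → ∀ N → applyUpTo a N ≡ applyUpTo b N
applyUpTo-cong eq zero    = refl
applyUpTo-cong eq (suc N) = cong₂ _∷_ (eq 0) (applyUpTo-cong (eq ∘ suc) N)

applyUpTo-injective : ∀ {a b : ℕ → ℕ} N → applyUpTo a N ≡ applyUpTo b N →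
                      ∀ n → n < N → a n ≡ b n
applyUpTo-injective (suc N) eq zero    _         = List.∷-injectiveˡ eq
applyUpTo-injective (suc N) eq (suc n) (s<s n<N) =
  applyUpTo-injective N (List.∷-injectiveʳ eq) n n<N

eval-applyUpTo : ∀ Y a N → eval Y (applyUpTo a N) ≡ ∑ (λ (i : Fin N) → + a (toℕ i) ℤ.* Y (toℕ i))
eval-applyUpTo Y a zero    = refl
eval-applyUpTo Y a (suc N) =
  cong (λ e → + a 0 ℤ.* Y 0 ℤ.+ e) (eval-applyUpTo (Y ∘ suc) (a ∘ suc) N)

eval-tabulate : ∀ Y {n} (f : Fin n → ℕ) →
                eval Y (tabulate f) ≡ ∑ (λ i → + f i ℤ.* Y (toℕ i))
eval-tabulate Y {zero}  f = refl
eval-tabulate Y {suc n} f = cong (λ e → + f zero ℤ.* Y 0 ℤ.+ e) (eval-tabulate (Y ∘ suc) (f ∘ suc))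

eval-vanishing : ∀ Y {a} N → (∀ n → a n ≡ 0) → eval Y (applyUpTo a N) ≡ 0ℤ
eval-vanishing Y zero    zeros = refl
eval-vanishing Y (suc N) zeros = cong₂ (λ x e → + x ℤ.* Y 0 ℤ.+ e) (zeros 0)
  (eval-vanishing (Y ∘ suc) N (zeros ∘ suc))

eval-truncate : ∀ Y {a} {B N} → B ≤ N → (∀ n → B ≤ n → a n ≡ 0) →
                eval Y (applyUpTo a N) ≡ eval Y (applyUpTo a B)
eval-truncate Y {N = N} z≤n       zeros = eval-vanishing Y N (λ n → zeros n z≤n)
eval-truncate Y {a}     (s≤s B≤N) zeros = cong (λ e → + a 0 ℤ.* Y 0 ℤ.+ e)
  (eval-truncate (Y ∘ suc) B≤N (λ n → zeros (suc n) ∘ s≤s))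

eval-map-* : ∀ Y m as → eval Y (map (m *_) as) ≡ + m ℤ.* eval Y as
eval-map-* Y m []       = sym (ℤ.*-zeroʳ (+ m))
eval-map-* Y m (a ∷ as) = trans
  (cong₂ (λ x e → x ℤ.* Y 0 ℤ.+ e) (ℤ.pos-* m a) (eval-map-* (Y ∘ suc) m as))
  (factor (+ m) (+ a) (Y 0) _)
  where
  factor : ∀ m a y e → m ℤ.* a ℤ.* y ℤ.+ m ℤ.* e ≡ m ℤ.* (a ℤ.* y ℤ.+ e)
  factor = ℤ-Solver.solve-∀

-- Positive coefficients are at least 1, so each multiple by `m` is at least `m`.
Prefix-map-* : ∀ {m qs cs} → All (_≤ m) qs → All (0 <_) cs → length qs ≤ length cs →
               Prefix _≤_ qs (map (m *_) cs)
Prefix-map-* []         _          _       = []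
Prefix-map-* {m} {cs = c ∷ _} (q≤m ∷ qs) (0<c ∷ cs) (s≤s len) =
  ℕ.≤-trans q≤m (ℕ.m≤m*n m c ⦃ >-nonZero 0<c ⦄) ∷ Prefix-map-* qs cs len

lastNonzero : ∀ as → (∀ n → digit as n ≡ 0) ⊎ ∃ (IsLastNonzero (digit as))
lastNonzero []       = inj₁ λ _ → refl
lastNonzero (a ∷ as) with lastNonzero as
... | inj₂ (m , pos , zeros) =
  inj₂ (suc m , pos , λ where (suc n) (s<s m<n) → zeros n m<n)
lastNonzero (zero  ∷ as) | inj₁ zeros = inj₁ λ where
  zero    → refl
  (suc n) → zeros n
lastNonzero (suc a ∷ as) | inj₁ zeros = inj₂ (0 , z<s , λ where (suc n) _ → zeros n)

-- Equivalence of `IsSR` with acceptance by the automaton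

module _ {k} (c : Vector ℤ (suc k)) (f : Fin (suc k) → ℕ) (c≗f : ∀ i → + f i ≡ c i)
         (f>0 : ∀ i → 0 < f i) where

  private
    cs : List ℕ
    cs = tabulate f

  -- Stated for any `g`, because after a match the automaton holds a proper suffix of the
  -- coefficients.
  admissible-block : ∀ {n} (g : Fin n → ℕ) (s : Fin n) a →
    (∀ i → toℕ i < toℕ s → a (toℕ i) ≡ g i) → a (toℕ s) < g s →
    (∀ N → Admissible cs cs (applyUpTo (shift (suc (toℕ s)) a) N)) →
    ∀ N → Admissible cs (tabulate g) (applyUpTo a N)
  admissible-block g s a eq lt adm zero = []
  admissible-block g zero a eq lt adm (suc N) = below lt (adm N)
  admissible-block {suc (suc n)} g (suc s) a eq lt adm (suc N) =
    subst (λ x → Admissible cs (tabulate g) (x ∷ applyUpTo (a ∘ suc) N)) (sym (eq zero z<s))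
      (match (admissible-block (g ∘ suc) s (a ∘ suc) (λ i → eq (suc i) ∘ s<s) lt adm N))

  admissible-zeros : ∀ ℓ {a} → (∀ n → n < ℓ → a n ≡ 0) →
    (∀ N → Admissible cs cs (applyUpTo (shift ℓ a) N)) →
    ∀ N → Admissible cs cs (applyUpTo a N)
  admissible-zeros zero    zeros adm N       = adm N
  admissible-zeros (suc ℓ) zeros adm zero    = []
  admissible-zeros (suc ℓ) zeros adm (suc N) =
    below (subst (_< f zero) (sym (zeros 0 z<s)) (f>0 zero))
      (admissible-zeros ℓ (λ n → zeros (suc n) ∘ s<s) adm N)

  admissible-null : ∀ {a} → (∀ n → a n ≡ 0) → ∀ N → Admissible cs cs (applyUpTo a N)
  admissible-null zeros zero    = []
  admissible-null zeros (suc N) =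
    below (subst (_< f zero) (sym (zeros 0)) (f>0 zero)) (admissible-null (zeros ∘ suc) N)

  IsSR⇒Admissible : ∀ {a} → IsSR c a → ∀ N → Admissible cs cs (applyUpTo a N)
  IsSR⇒Admissible (null zeros) = admissible-null zeros
  -- A prefix is read as a block: the zero after its last nonzero term lies below a positive
  -- coefficient, and only zeros follow.
  IsSR⇒Admissible {a} (prefix m (_ , zeros) m+1<k eq) =
    admissible-block f s a (λ i i<s → ℤ.+-injective (trans (eq i (i≤m i i<s)) (sym (c≗f i))))
      (subst (_< f s) (sym (zeros (toℕ s) (ℕ.≤-reflexive (sym s≡)))) (f>0 s))
      (admissible-null λ n → zeros _
        (ℕ.≤-trans (ℕ.≤-reflexive (sym s≡)) (ℕ.≤-trans (ℕ.n≤1+n _) (ℕ.m≤m+n _ n))))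
    where
    s : Fin (suc k)
    s = fromℕ< m+1<k
    s≡ : toℕ s ≡ suc m
    s≡ = Fin.toℕ-fromℕ< m+1<k
    i≤m : ∀ i → toℕ i < toℕ s → toℕ i ≤ m
    i≤m i i<s = s≤s⁻¹ (subst (toℕ i <_) s≡ i<s)
  IsSR⇒Admissible {a} (block m _ s ℓ eq lt zeros sr) =
    admissible-block f s a (λ i i<s → ℤ.+-injective (trans (eq i i<s) (sym (c≗f i))))
      (ℤ.drop‿+<+ (subst (ℤ._<_ (+ a (toℕ s))) (sym (c≗f s)) lt))
      (admissible-zeros ℓ zeros λ N → subst (Admissible cs cs)
        (applyUpTo-cong (λ n → cong a (ℕ.+-assoc (suc (toℕ s)) ℓ n)) N) (IsSR⇒Admissible sr N))

  -- Digits beyond the end of the list count as zeros, so a block can always be split off.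
  record LeadingBlock {n} (g : Fin n → ℕ) (as : List ℕ) : Set where
    constructor leadingBlock
    field
      stop       : Fin n
      rest       : List ℕ
      agree      : ∀ i → toℕ i < toℕ stop → digit as (toℕ i) ≡ g i
      drop       : digit as (toℕ stop) < g stop
      rest-digit : ∀ m → digit as (suc (toℕ stop) + m) ≡ digit rest m
      admissible : Admissible cs cs rest
      shorter    : length rest ≤ pred (length as)

  leading-block : ∀ {n} (g : Fin (suc n) → ℕ) → (∀ i → 0 < g i) → ∀ {as} →
                  Admissible cs (tabulate g) as → LeadingBlock g as
  leading-block {suc n} g g>0 {a ∷ as} (match adm)
    with leadingBlock s rest agree drop rest-digit adm′ shorter ←
           leading-block (g ∘ suc) (g>0 ∘ suc) adm
    = leadingBlock (suc s) rest agree′ drop rest-digit adm′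
        (ℕ.≤-trans shorter ℕ.pred[n]≤n)
    where
    agree′ : ∀ i → toℕ i < suc (toℕ s) → digit (g zero ∷ as) (toℕ i) ≡ g i
    agree′ zero    _         = refl
    agree′ (suc i) (s<s i<s) = agree i i<s
  leading-block g g>0 [] =
    leadingBlock zero [] (λ _ ()) (g>0 zero) (λ _ → refl) [] z≤n
  leading-block g g>0 {a ∷ as} (below a<x adm) =
    leadingBlock zero as (λ _ ()) a<x (λ _ → refl) adm ℕ.≤-refl

  -- Each block is taken with ℓ = 0, since a later zero drops below the first coefficient and forms
  -- a block of its own. The remaining digits are not a structural part of `as`, hence the bound
  -- `n`; the shifted sequence agrees with them only pointwise, hence `≗`.
  Admissible⇒IsSR : ∀ n as → length as ≤ n → Admissible cs cs as →
                    ∀ {a} → a ≗ digit as → IsSR c a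
  Admissible⇒IsSR n as len adm {a} eq with lastNonzero as
  ... | inj₁ zeros = null λ n → trans (eq n) (zeros n)
  Admissible⇒IsSR zero [] len adm eq | inj₂ (m , () , _)
  Admissible⇒IsSR (suc n) as len adm {a} eq | inj₂ (m , pos , zeros)
    with leadingBlock s rest agree drop rest-digit adm′ shorter ← leading-block f f>0 adm
    = block m (subst (0 <_) (sym (eq m)) pos , λ n m<n → trans (eq n) (zeros n m<n)) s 0
        (λ i i<s → trans (cong +_ (trans (eq (toℕ i)) (agree i i<s))) (c≗f i))
        (subst₂ ℤ._<_ (cong +_ (sym (eq (toℕ s)))) (c≗f s) (ℤ.+<+ drop))
        (λ _ ())
        (Admissible⇒IsSR n rest (ℕ.≤-trans shorter (ℕ.pred-mono-≤ len)) adm′ λ m →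
          trans (eq _) (trans (cong (λ p → digit as (p + m)) (ℕ.+-identityʳ (suc (toℕ s))))
            (rest-digit m)))

-- Representations of vectors

basis-suc : ∀ {d} (i j : Fin d) → basis (suc i) (suc j) ≡ basis i j
basis-suc i j with i Fin.≟ j
... | yes _ = refl
... | no  _ = refl

∑-zero : ∀ {d} {w : Vector ℤ d} → (∀ i → w i ≡ 0ℤ) → ∑ w ≡ 0ℤ
∑-zero {d} zeros = trans (sum-cong-≗ zeros) (sum-replicate-zero d)

∑-*-basis : ∀ {d} (w : Vector ℤ d) j → ∑ (λ i → w i ℤ.* basis i j) ≡ w j
∑-*-basis w zero = trans
  (cong₂ ℤ._+_ (ℤ.*-identityʳ (w zero)) (∑-zero (λ i → ℤ.*-zeroʳ (w (suc i)))))
  (ℤ.+-identityʳ (w zero))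
∑-*-basis w (suc j) = trans
  (cong₂ ℤ._+_ (ℤ.*-zeroʳ (w zero))
    (trans (sum-cong-≗ (λ i → cong (w (suc i) ℤ.*_) (basis-suc i j))) (∑-*-basis (w ∘ suc) j)))
  (ℤ.+-identityˡ (w (suc j)))

∑-basis-* : ∀ {d} (w : Vector ℤ d) i → ∑ (λ j → basis i j ℤ.* w j) ≡ w i
∑-basis-* w zero = trans
  (cong₂ ℤ._+_ (ℤ.*-identityˡ (w zero)) (∑-zero (λ j → ℤ.*-zeroˡ (w (suc j)))))
  (ℤ.+-identityʳ (w zero))
∑-basis-* w (suc i) = trans
  (cong₂ ℤ._+_ (ℤ.*-zeroˡ (w zero))
    (trans (sum-cong-≗ (λ j → cong (ℤ._* w (suc j)) (basis-suc i j))) (∑-basis-* (w ∘ suc) i)))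
  (ℤ.+-identityˡ (w (suc i)))

posPart negPart : ℤ → ℕ
posPart (+ n)    = n
posPart -[1+ n ] = 0
negPart (+ n)    = 0
negPart -[1+ n ] = suc n

posPart-negPart : ∀ i → + posPart i ℤ.- + negPart i ≡ i
posPart-negPart (+ n)    = ℤ.+-identityʳ (+ n)
posPart-negPart -[1+ n ] = refl

-- Existence and uniqueness of the representation

module _ {d} (c : Vector ℤ (suc (suc d))) (dec : NonIncreasing c) (last : LastIsOne c)
         (X : ℤ → Vector ℤ (suc d)) (isRec : IsRecurrenceSequence c X) where

  open IsRecurrenceSequence isRec

  private
    f : Fin (suc (suc d)) → ℕ
    f i = ℤ.∣ c i ∣

    cs : List ℕ
    cs = tabulate f

    c-last : c (fromℕ (suc d)) ≡ 1ℤ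
    c-last = last _ (cong suc (Fin.toℕ-fromℕ (suc d)))

    -- Each coefficient is at least the last one, which is 1.
    0<c : ∀ i → 0ℤ ℤ.< c i
    0<c i = ℤ.<-≤-trans (ℤ.+<+ z<s)
      (subst (ℤ._≤ c i) c-last (dec i _ (Fin.≤fromℕ i)))

    c≗f : ∀ i → + f i ≡ c i
    c≗f i = ℤ.0≤i⇒+∣i∣≡i (ℤ.<⇒≤ (0<c i))

    f>0 : ∀ i → 0 < f i
    f>0 i = ℤ.drop‿+<+ (subst (0ℤ ℤ.<_) (sym (c≗f i)) (0<c i))

    positive : All (0 <_) cs
    positive = All.tabulate⁺ f>0

    decreasing : Linked _≥_ cs
    decreasing = Linked.AllPairs⇒Linked (AllPairs.tabulate⁺-< {f = f} λ {i} {j} i<j →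
      ℤ.drop‿+≤+ (subst₂ ℤ._≤_ (sym (c≗f j)) (sym (c≗f i)) (dec i j (ℕ.<⇒≤ i<j))))

    -- With this sign, `Z j ∘ suc` agrees by computation with the vectors summed in `value`.
    Z : Fin (suc d) → ℕ → ℤ
    Z j n = X (ℤ.- + n) j

    Z-recurrent : ∀ j → Recurrent cs (Z j)
    Z-recurrent j n = trans (recurrence (ℤ.- + n) j) (sym (trans
      (eval-tabulate (λ i → Z j (suc n + i)) f)
      (sum-cong-≗ λ i → cong₂ (λ a m → a ℤ.* X m j) (c≗f i)
        (trans (cong (λ m → ℤ.- + m) (sym (ℕ.+-suc n (toℕ i))))
          (ℤ.neg-distrib-+ (+ n) (+ suc (toℕ i)))))))

  -- Padding with zeros brings two sequences to a common length.
  value≡eval : ∀ a j {N} → bound a ≤ N →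
               value X a j ≡ eval (Z j ∘ suc) (applyUpTo (term a) N)
  value≡eval a j N≥ = sym (trans (eval-truncate (Z j ∘ suc) N≥ (vanishes a))
    (eval-applyUpTo (Z j ∘ suc) (term a) (bound a)))

  -- cs evaluates to X₀ = 0, so a multiple of it makes up for the negative entries of v.
  nonnegative-digits : ∀ v → ∃ λ as → ∀ j → eval (Z j ∘ suc) as ≡ v j
  nonnegative-digits v = ps ⊕ (map (m *_) cs ⊖ qs) , λ j → begin
    eval (Z j ∘ suc) (ps ⊕ (map (m *_) cs ⊖ qs))
      ≡⟨ eval-⊕ (Z j ∘ suc) ps _ ⟩
    eval (Z j ∘ suc) ps ℤ.+ eval (Z j ∘ suc) (map (m *_) cs ⊖ qs)
      ≡⟨ cong₂ ℤ._+_ (eval-basis j (posPart ∘ v)) (trans (difference j)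
          (cong ℤ.-_ (eval-basis j (negPart ∘ v)))) ⟩
    + posPart (v j) ℤ.- + negPart (v j)
      ≡⟨ posPart-negPart (v j) ⟩
    v j ∎
    where
    open ≡-Reasoning
    ps qs : List ℕ
    ps = tabulate (posPart ∘ v)
    qs = tabulate (negPart ∘ v)
    m : ℕ
    m = max 0 qs
    eval-basis : ∀ j (g : Fin (suc d) → ℕ) → eval (Z j ∘ suc) (tabulate g) ≡ + g j
    eval-basis j g = trans (eval-tabulate (Z j ∘ suc) g)
      (trans (sum-cong-≗ (λ i → cong (+ g i ℤ.*_) (at-neg i j))) (∑-*-basis (+_ ∘ g) j))
    qs≤ : Prefix _≤_ qs (map (m *_) cs)
    qs≤ = Prefix-map-* (xs≤max 0 qs) positive
      (subst₂ _≤_ (sym (List.length-tabulate (negPart ∘ v))) (sym (List.length-tabulate f))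
        (ℕ.n≤1+n _))
    difference : ∀ j → eval (Z j ∘ suc) (map (m *_) cs ⊖ qs) ≡ ℤ.- eval (Z j ∘ suc) qs
    difference j = negate (begin
      eval (Z j ∘ suc) (map (m *_) cs ⊖ qs) ℤ.+ eval (Z j ∘ suc) qs
        ≡⟨ eval-⊖ (Z j ∘ suc) qs≤ ⟩
      eval (Z j ∘ suc) (map (m *_) cs)
        ≡⟨ eval-map-* (Z j ∘ suc) m cs ⟩
      + m ℤ.* eval (Z j ∘ suc) cs
        ≡⟨ cong (+ m ℤ.*_) (trans (sym (Z-recurrent j 0)) (at-zero j)) ⟩
      + m ℤ.* 0ℤ
        ≡⟨ ℤ.*-zeroʳ (+ m) ⟩
      0ℤ ∎)
      where
      negate : ∀ {x y} → x ℤ.+ y ≡ 0ℤ → x ≡ ℤ.- y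
      negate {x} {y} eq = ℤ.i-j≡0⇒i≡j x (ℤ.- y)
        (trans (cong (λ e → x ℤ.+ e) (ℤ.neg-involutive y)) eq)

  admissible-represents : ∀ v bs → Admissible cs cs bs →
    (∀ j → eval (Z j ∘ suc) bs ≡ v j) → ∃ (IsSRof c X v)
  admissible-represents v bs adm bs≡v =
    b , Admissible⇒IsSR c f c≗f f>0 (length bs) bs ℕ.≤-refl adm (λ _ → refl) , λ j → begin
      v j
        ≡⟨ bs≡v j ⟨
      eval (Z j ∘ suc) bs
        ≡⟨ cong (eval (Z j ∘ suc)) (applyUpTo-digit bs) ⟨
      eval (Z j ∘ suc) (applyUpTo (digit bs) (length bs))
        ≡⟨ value≡eval b j ℕ.≤-refl ⟨
      value X b j ∎
    where
    open ≡-Reasoning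
    b : FiniteSequence
    b = record { term = digit bs ; bound = length bs ; vanishes = digit-vanishes bs }

  SR-exists : ∀ v → ∃ (IsSRof c X v)
  SR-exists v =
    let as , as≡v            = nonnegative-digits v
        bs , adm , _ , bs≡as = normalize positive decreasing (sum as) as ℕ.≤-refl
    in admissible-represents v bs adm λ j →
         trans (bs≡as (Z j) (Z-recurrent j) (at-zero j)) (as≡v j)

  -- Modulo `g` each weight is congruent to the value of the functional `P` on the represented
  -- vector. The vectors agree and both weights are below `g`, so the weights are equal.
  admissible-unique : ∀ {as bs} → Admissible cs cs as → Admissible cs cs bs →
    length as ≡ length bs → (∀ j → eval (Z j ∘ suc) as ≡ eval (Z j ∘ suc) bs) → as ≡ bs
  admissible-unique {as} {bs} adm adm′ len eq =
    weigh-injective positive n adm adm′ len ℕ.≤-refl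
      (∣-difference⇒≡ (weigh< positive n positive adm ℕ.≤-refl)
        (weigh< positive n positive adm′ (ℕ.≤-reflexive (sym len)))
        (subst (+ g ∣_) cancel (ℤ.∣m∣n⇒∣m-n (congruent as ℕ.≤-refl)
          (congruent bs (ℕ.≤-reflexive (sym len))))))
    where
    n g : ℕ
    n = length as
    g = window cs (suc n) 0
    -- `P` is the pairing with `w`; on the basis vectors X₋₁, X₋₂, ... it takes the values of
    -- `window cs n`.
    w : Vector ℤ (suc d)
    w i = + window cs n (toℕ i)
    P : ℕ → ℤ
    P i = ∑ (λ j → Z j i ℤ.* w j)
    P-recurrent : Recurrent cs P
    P-recurrent i = trans (sum-cong-≗ (λ j → cong (ℤ._* w j) (Z-recurrent j i)))
      (sym (eval-∑ (λ j m → Z j (suc i + m)) w cs))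
    P-neg : ∀ i → i < suc d → P (suc i) ≡ + window cs n i
    P-neg i i<d = subst (λ m → P (suc m) ≡ + window cs n m) (Fin.toℕ-fromℕ< i<d)
      (trans (sum-cong-≗ (λ j → cong (ℤ._* w j) (at-neg (fromℕ< i<d) j)))
        (∑-basis-* w (fromℕ< i<d)))
    congruent : ∀ ds → length ds ≤ n →
                + g ∣ + weigh (window cs n) ds ℤ.- eval (P ∘ suc) ds
    congruent ds ds≤n = subst (+ g ∣_)
      (trans (eval-minus (+_ ∘ window cs n) (P ∘ suc) ds)
        (cong (ℤ._- eval (P ∘ suc) ds) (eval-weigh (window cs n) ds)))
      (∣-eval (λ i → + window cs n i ℤ.- P (suc i)) ds λ i i<ds →
        window-congruent f (cong ℤ.∣_∣ c-last) n P-recurrent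
          (∑-zero λ j → trans (cong (ℤ._* w j) (at-zero j)) (ℤ.*-zeroˡ (w j)))
          P-neg i (ℕ.<-≤-trans i<ds ds≤n))
    P-eq : eval (P ∘ suc) as ≡ eval (P ∘ suc) bs
    P-eq = trans (eval-∑ (λ j → Z j ∘ suc) w as)
      (trans (sum-cong-≗ (λ j → cong (ℤ._* w j) (eq j))) (sym (eval-∑ (λ j → Z j ∘ suc) w bs)))
    cancel : + weigh (window cs n) as ℤ.- eval (P ∘ suc) as ℤ.-
             (+ weigh (window cs n) bs ℤ.- eval (P ∘ suc) bs) ≡
             + weigh (window cs n) as ℤ.- + weigh (window cs n) bs
    cancel = trans (cong (λ e → + weigh (window cs n) as ℤ.- e ℤ.-
      (+ weigh (window cs n) bs ℤ.- eval (P ∘ suc) bs)) P-eq)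
      (telescope (+ weigh (window cs n) as) (+ weigh (window cs n) bs) (eval (P ∘ suc) bs))
      where
      telescope : ∀ x y p → x ℤ.- p ℤ.- (y ℤ.- p) ≡ x ℤ.- y
      telescope = ℤ-Solver.solve-∀

  SR-unique : ∀ v a b → IsSRof c X v a → IsSRof c X v b → a ≈ b
  SR-unique v a b (sra , v≗a) (srb , v≗b) i =
    applyUpTo-injective {term a} {term b} N lists≡ i (ℕ.m≤m+n (suc i) _)
    where
    -- Truncation at `N` keeps the term at `i` and both values.
    N : ℕ
    N = suc i + (bound a + bound b)
    a≤N : bound a ≤ N
    a≤N = ℕ.≤-trans (ℕ.m≤m+n (bound a) _) (ℕ.m≤n+m _ (suc i))
    b≤N : bound b ≤ N
    b≤N = ℕ.≤-trans (ℕ.m≤n+m (bound b) (bound a)) (ℕ.m≤n+m _ (suc i))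
    lists≡ : applyUpTo (term a) N ≡ applyUpTo (term b) N
    lists≡ = admissible-unique
      (IsSR⇒Admissible c f c≗f f>0 sra N) (IsSR⇒Admissible c f c≗f f>0 srb N)
      (trans (List.length-applyUpTo (term a) N) (sym (List.length-applyUpTo (term b) N)))
      λ j → trans (sym (value≡eval a j a≤N))
        (trans (trans (sym (v≗a j)) (v≗b j)) (value≡eval b j b≤N))

theorem1p10 : ∀ k → 2 ≤ k →
    (c : Vector ℤ k) → NonIncreasing c → LastIsOne c →
    (X : ℤ → Vector ℤ (k ∸ 1)) → IsRecurrenceSequence c X →
    (v : Vector ℤ (k ∸ 1)) → ∃! _≈_ (IsSRof c X v)
theorem1p10 (suc (suc d)) (s≤s (s≤s z≤n)) c dec last X isRec v =
  let a , isSR = SR-exists c dec last X isRec v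
  in a , isSR , λ {b} → SR-unique c dec last X isRec v a b isSR
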